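{- Let $\alpha,\beta$ be any real numbers and let $n$ be any positive integer. Then $$\sum_{k=1}^{n}(-\beta)^k B_{n,k}\big(0!\,\alpha,\,-1!\,\alpha^2\beta,\,\ldots,\,(-1)^{n-k}(n-k)!\,\alpha^{n-k+1}\beta^{n-k}\big)=n!\,(-\alpha\beta)^n,$$ where the $j$-th argument of $B_{n,k}$ is $(-1)^{j-1}(j-1)!\,\alpha^{j}\beta^{j-1}$ for $1\le j\le n-k+1$.
   Context: For integers $1\le k\le n$, the partial exponential Bell polynomial is $$B_{n,k}(x_1,\ldots,x_{n-k+1})=n!\sum_{\Lambda^k_n}\prod_{j=1}^{n-k+1}\frac{1}{k_j!}\Big(\frac{x_j}{j!}\Big)^{k_j},$$ where the sum is over $\Lambda^k_n=\{(k_1,\ldots,k_{n-k+1}): \sum_j k_j=k,\ \sum_j jk_j=n,\ k_j\in\mathbb{Z}_{\ge 0}\}$. The convention $0^0=1$ is used. -}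

module Defs where

open import Algebra.Bundles using (CommutativeRing; Semiring)
open import Data.Fin.Base using (toℕ)
open import Data.Integer.Base using (+_)
open import Data.List.Base as List using (List; []; _∷_; cartesianProductWith; filter; foldr; upTo)
open import Data.List.Membership.Propositional using (_∈_)
open import Data.List.Membership.Propositional.Properties
  using (∈-cartesianProductWith⁺; ∈-filter⁺; ∈-filter⁻; ∈-upTo⁺)
open import Data.List.Relation.Unary.All using ([])
open import Data.List.Relation.Unary.AllPairs using ([]; _∷_)
open import Data.List.Relation.Unary.Any using (here)
open import Data.List.Relation.Unary.Unique.Propositional using (Unique)
open import Data.List.Relation.Unary.Unique.Propositional.Properties using (cartesianProductWith⁺; filter⁺; upTo⁺)
open import Data.Nat.Base as ℕ using (ℕ; zero; suc; _∸_; _!; z≤n; s≤s)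
import Data.Nat.Properties as ℕₚ
open import Data.Product.Base using (∃-syntax; _×_; _,_; proj₁; proj₂)
open import Data.Rational.Base as ℚ using (ℚ; 0ℚ; 1ℚ; ½; ∣_∣)
import Data.Rational.Properties as ℚₚ
open import Data.Rational.Solver using (module +-*-Solver)
open import Data.Vec.Base as Vec using (Vec; []; _∷_)
open import Data.Vec.Functional using (Vector)
open import Data.Vec.Properties using (∷-injective)
open import Function.Base using (case_of_)
open import Function.Bundles using (_⇔_; mk⇔)
open import Level using (0ℓ)
open import Relation.Binary.PropositionalEquality
  using (_≡_; refl; sym; trans; cong; subst)
open import Relation.Binary.Structures using (IsEquivalence)
open import Relation.Nullary.Decidable using (_×-dec_)
open import Relation.Unary using (Decidable)

------------------------------------------------------------------------
-- Real numbers: Cauchy sequences of rationals, with the setoid equality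
-- "the difference tends to 0" playing the role of the quotient.  Records without
-- eta and copattern definitions keep the operations from unfolding in unification.

IsCauchy : (ℕ → ℚ) → Set
IsCauchy s = ∀ ε → 0ℚ ℚ.< ε → ∃[ N ] (∀ m n → N ℕ.≤ m → N ℕ.≤ n → ∣ s m ℚ.- s n ∣ ℚ.< ε)

record ℝ : Set where
  no-eta-equality
  field
    seq    : ℕ → ℚ
    cauchy : IsCauchy seq

open ℝ public

infix 4 _≈_

-- A record rather than a function, so that x and y can be inferred from x ≈ y.
record _≈_ (x y : ℝ) : Set where
  no-eta-equality
  constructor mk≈
  field
    converge : ∀ ε → 0ℚ ℚ.< ε → ∃[ N ] (∀ n → N ℕ.≤ n → ∣ seq x n ℚ.- seq y n ∣ ℚ.< ε)

open _≈_ public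

private

  Null : (ℕ → ℕ → ℚ) → Set
  Null f = ∀ ε → 0ℚ ℚ.< ε → ∃[ N ] (∀ m n → N ℕ.≤ m → N ℕ.≤ n → ∣ f m n ∣ ℚ.< ε)

  Bounded : (ℕ → ℕ → ℚ) → Set
  Bounded f = ∃[ b ] 0ℚ ℚ.< b × ∃[ N ] (∀ m n → N ℕ.≤ m → N ℕ.≤ n → ∣ f m n ∣ ℚ.< b)

  open +-*-Solver using (solve; _:=_; _:+_; _:*_; _:-_; :-_)

  abstract

    null-resp : ∀ {f g} → (∀ m n → f m n ≡ g m n) → Null f → Null g
    null-resp f≗g f0 ε ε>0 with N , p ← f0 ε ε>0 =
      N , λ m n N≤m N≤n → subst (λ q → ∣ q ∣ ℚ.< ε) (f≗g m n) (p m n N≤m N≤n)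

    null-0 : Null (λ _ _ → 0ℚ)
    null-0 ε ε>0 = 0 , λ _ _ _ _ → ε>0

    null-neg : ∀ {f} → Null f → Null (λ m n → ℚ.- f m n)
    null-neg {f} f0 ε ε>0 with N , p ← f0 ε ε>0 =
      N , λ m n N≤m N≤n → subst (ℚ._< ε) (sym (ℚₚ.∣-p∣≡∣p∣ (f m n))) (p m n N≤m N≤n)

    null-+ : ∀ {f g} → Null f → Null g → Null (λ m n → f m n ℚ.+ g m n)
    null-+ {f} {g} f0 g0 ε ε>0
      with M , p ← f0 (½ ℚ.* ε) (ℚₚ.*-monoʳ-<-pos ½ ε>0)
         | N , q ← g0 (½ ℚ.* ε) (ℚₚ.*-monoʳ-<-pos ½ ε>0)
      = M ℕ.⊔ N , λ m n hm hn →
        ℚₚ.≤-<-trans (ℚₚ.∣p+q∣≤∣p∣+∣q∣ (f m n) (g m n))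
          (subst (∣ f m n ∣ ℚ.+ ∣ g m n ∣ ℚ.<_) halves
            (ℚₚ.+-mono-< (p m n (ℕₚ.m⊔n≤o⇒m≤o M N hm) (ℕₚ.m⊔n≤o⇒m≤o M N hn))
                         (q m n (ℕₚ.m⊔n≤o⇒n≤o M N hm) (ℕₚ.m⊔n≤o⇒n≤o M N hn))))
      where
      halves : ½ ℚ.* ε ℚ.+ ½ ℚ.* ε ≡ ε
      halves = trans (sym (ℚₚ.*-distribʳ-+ ε ½ ½)) (ℚₚ.*-identityˡ ε)

    null-* : ∀ {f g} → Bounded f → Null g → Null (λ m n → f m n ℚ.* g m n)
    null-* {f} {g} (b , b>0 , M , p) g0 ε ε>0 = M ℕ.⊔ N , λ m n hm hn →
        ℚₚ.≤-<-trans
          (ℚₚ.≤-trans (ℚₚ.≤-reflexive (ℚₚ.∣p*q∣≡∣p∣*∣q∣ (f m n) (g m n)))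
            (ℚₚ.*-monoʳ-≤-nonNeg ∣ g m n ∣ {{ℚₚ.∣-∣-nonNeg (g m n)}}
              (ℚₚ.<⇒≤ (p m n (ℕₚ.m⊔n≤o⇒m≤o M N hm) (ℕₚ.m⊔n≤o⇒m≤o M N hn)))))
          (subst (b ℚ.* ∣ g m n ∣ ℚ.<_) b*δ≡ε
            (ℚₚ.*-monoʳ-<-pos b
              (q m n (ℕₚ.m⊔n≤o⇒n≤o M N hm) (ℕₚ.m⊔n≤o⇒n≤o M N hn))))
      where
      instance
        pos-b : ℚ.Positive b
        pos-b = ℚ.positive b>0
        nz-b : ℚ.NonZero b
        nz-b = ℚₚ.pos⇒nonZero b
        pos-1/b : ℚ.Positive (ℚ.1/ b)
        pos-1/b = ℚₚ.1/pos⇒pos b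
      δ : ℚ
      δ = ℚ.1/ b ℚ.* ε
      δ>0 : 0ℚ ℚ.< δ
      δ>0 = subst (ℚ._< δ) (ℚₚ.*-zeroʳ (ℚ.1/ b)) (ℚₚ.*-monoʳ-<-pos (ℚ.1/ b) ε>0)
      N : ℕ
      N = proj₁ (g0 δ δ>0)
      q : ∀ m n → N ℕ.≤ m → N ℕ.≤ n → ∣ g m n ∣ ℚ.< δ
      q = proj₂ (g0 δ δ>0)
      b*δ≡ε : b ℚ.* δ ≡ ε
      b*δ≡ε = trans (sym (ℚₚ.*-assoc b (ℚ.1/ b) ε))
                (trans (cong (ℚ._* ε) (ℚₚ.*-inverseʳ b)) (ℚₚ.*-identityˡ ε))

    bound : (x : ℝ) → ∃[ b ] 0ℚ ℚ.< b × ∃[ N ] (∀ n → N ℕ.≤ n → ∣ seq x n ∣ ℚ.< b)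
    bound x with N , p ← cauchy x 1ℚ (ℚₚ.positive⁻¹ 1ℚ) =
        1ℚ ℚ.+ ∣ seq x N ∣
      , ℚₚ.<-≤-trans (ℚₚ.positive⁻¹ 1ℚ)
          (subst (ℚ._≤ 1ℚ ℚ.+ ∣ seq x N ∣) (ℚₚ.+-identityʳ 1ℚ) (ℚₚ.+-monoʳ-≤ 1ℚ (ℚₚ.0≤∣p∣ (seq x N))))
      , N , λ n N≤n → ℚₚ.≤-<-trans
          (subst (λ q → ∣ q ∣ ℚ.≤ ∣ seq x n ℚ.- seq x N ∣ ℚ.+ ∣ seq x N ∣)
            (solve 2 (λ a c → (a :- c) :+ c := a) refl (seq x n) (seq x N))
            (ℚₚ.∣p+q∣≤∣p∣+∣q∣ (seq x n ℚ.- seq x N) (seq x N)))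
          (ℚₚ.+-monoˡ-< ∣ seq x N ∣ (p n N N≤n ℕₚ.≤-refl))

    boundedˡ : (x : ℝ) → Bounded (λ m _ → seq x m)
    boundedˡ x = lift (bound x)
      where
      lift : ∃[ b ] 0ℚ ℚ.< b × ∃[ N ] (∀ n → N ℕ.≤ n → ∣ seq x n ∣ ℚ.< b) → Bounded (λ m _ → seq x m)
      lift (b , b>0 , N , p) = b , b>0 , N , λ m _ N≤m _ → p m N≤m

    boundedʳ : (x : ℝ) → Bounded (λ _ n → seq x n)
    boundedʳ x = swap (boundedˡ x)
      where
      swap : ∀ {f} → Bounded f → Bounded (λ m n → f n m)
      swap (b , b>0 , N , p) = b , b>0 , N , λ m n N≤m N≤n → p n m N≤n N≤m

    ≈⇒null : ∀ {x y} → x ≈ y → Null (λ m _ → seq x m ℚ.- seq y m)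
    ≈⇒null x≈y ε ε>0 with N , p ← converge x≈y ε ε>0 = N , λ m _ N≤m _ → p m N≤m

    null⇒≈ : ∀ {x y} → Null (λ m _ → seq x m ℚ.- seq y m) → x ≈ y
    null⇒≈ f0 = mk≈ λ ε ε>0 → case f0 ε ε>0 of λ where
      (N , p) → N , λ n N≤n → p n n N≤n N≤n

    const-cauchy : ∀ q → IsCauchy (λ _ → q)
    const-cauchy q = null-resp (λ _ _ → sym (ℚₚ.+-inverseʳ q)) null-0

    +-cauchy : ∀ x y → IsCauchy (λ n → seq x n ℚ.+ seq y n)
    +-cauchy x y = null-resp
      (λ m n → solve 4 (λ a b c d → (a :- b) :+ (c :- d) := (a :+ c) :- (b :+ d)) refl
                 (seq x m) (seq x n) (seq y m) (seq y n))
      (null-+ (cauchy x) (cauchy y))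

    neg-cauchy : ∀ x → IsCauchy (λ n → ℚ.- seq x n)
    neg-cauchy x = null-resp
      (λ m n → solve 2 (λ a b → :- (a :- b) := (:- a) :- (:- b)) refl (seq x m) (seq x n))
      (null-neg (cauchy x))

    *-cauchy : ∀ x y → IsCauchy (λ n → seq x n ℚ.* seq y n)
    *-cauchy x y = null-resp
      (λ m n → solve 4 (λ a b c d → a :* (c :- d) :+ d :* (a :- b) := a :* c :- b :* d) refl
                 (seq x m) (seq x n) (seq y m) (seq y n))
      (null-+ (null-* (boundedˡ x) (cauchy y)) (null-* (boundedʳ y) (cauchy x)))

infix  8 -_
infixl 7 _*_
infixl 6 _+_

fromℚ : ℚ → ℝ
seq    (fromℚ q) _ = q
cauchy (fromℚ q)   = const-cauchy q

fromℕ : ℕ → ℝ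
fromℕ n = fromℚ (+ n ℚ./ 1)

0ℝ 1ℝ : ℝ
0ℝ = fromℚ 0ℚ
1ℝ = fromℚ 1ℚ

_+_ : ℝ → ℝ → ℝ
seq    (x + y) n = seq x n ℚ.+ seq y n
cauchy (x + y)   = +-cauchy x y

-_ : ℝ → ℝ
seq    (- x) n = ℚ.- seq x n
cauchy (- x)   = neg-cauchy x

_*_ : ℝ → ℝ → ℝ
seq    (x * y) n = seq x n ℚ.* seq y n
cauchy (x * y)   = *-cauchy x y

pointwise : ∀ {x y} → (∀ n → seq x n ≡ seq y n) → x ≈ y
pointwise {x} {y} x≗y = null⇒≈ (null-resp
  (λ m _ → trans (sym (ℚₚ.+-inverseʳ (seq y m))) (cong (ℚ._- seq y m) (sym (x≗y m)))) null-0)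

≈-isEquivalence : IsEquivalence _≈_
≈-isEquivalence = record
  { refl  = pointwise λ _ → refl
  ; sym   = λ {x} {y} x≈y → null⇒≈ (null-resp
      (λ m _ → solve 2 (λ a b → :- (a :- b) := b :- a) refl (seq x m) (seq y m))
      (null-neg (≈⇒null x≈y)))
  ; trans = λ {x} {y} {z} x≈y y≈z → null⇒≈ (null-resp
      (λ m _ → solve 3 (λ a b c → (a :- b) :+ (b :- c) := a :- c) refl (seq x m) (seq y m) (seq z m))
      (null-+ (≈⇒null x≈y) (≈⇒null y≈z)))
  }

+-cong : ∀ {x y u v} → x ≈ y → u ≈ v → x + u ≈ y + v
+-cong {x} {y} {u} {v} x≈y u≈v = null⇒≈ (null-resp
  (λ m _ → solve 4 (λ a b c d → (a :- b) :+ (c :- d) := (a :+ c) :- (b :+ d)) refl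
             (seq x m) (seq y m) (seq u m) (seq v m))
  (null-+ (≈⇒null x≈y) (≈⇒null u≈v)))

-‿cong : ∀ {x y} → x ≈ y → - x ≈ - y
-‿cong {x} {y} x≈y = null⇒≈ (null-resp
  (λ m _ → solve 2 (λ a b → :- (a :- b) := (:- a) :- (:- b)) refl (seq x m) (seq y m))
  (null-neg (≈⇒null x≈y)))

*-cong : ∀ {x y u v} → x ≈ y → u ≈ v → x * u ≈ y * v
*-cong {x} {y} {u} {v} x≈y u≈v = null⇒≈ (null-resp
  (λ m _ → solve 4 (λ a b c d → a :* (c :- d) :+ d :* (a :- b) := a :* c :- b :* d) refl
             (seq x m) (seq y m) (seq u m) (seq v m))
  (null-+ (null-* (boundedˡ x) (≈⇒null u≈v)) (null-* (boundedˡ v) (≈⇒null x≈y))))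

+-assoc : ∀ x y z → (x + y) + z ≈ x + (y + z)
+-assoc x y z = pointwise λ n → ℚₚ.+-assoc (seq x n) (seq y n) (seq z n)

+-comm : ∀ x y → x + y ≈ y + x
+-comm x y = pointwise λ n → ℚₚ.+-comm (seq x n) (seq y n)

+-identityˡ : ∀ x → 0ℝ + x ≈ x
+-identityˡ x = pointwise λ n → ℚₚ.+-identityˡ (seq x n)

+-identityʳ : ∀ x → x + 0ℝ ≈ x
+-identityʳ x = pointwise λ n → ℚₚ.+-identityʳ (seq x n)

-‿inverseˡ : ∀ x → - x + x ≈ 0ℝ
-‿inverseˡ x = pointwise λ n → ℚₚ.+-inverseˡ (seq x n)

-‿inverseʳ : ∀ x → x + - x ≈ 0ℝ
-‿inverseʳ x = pointwise λ n → ℚₚ.+-inverseʳ (seq x n)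

*-assoc : ∀ x y z → (x * y) * z ≈ x * (y * z)
*-assoc x y z = pointwise λ n → ℚₚ.*-assoc (seq x n) (seq y n) (seq z n)

*-comm : ∀ x y → x * y ≈ y * x
*-comm x y = pointwise λ n → ℚₚ.*-comm (seq x n) (seq y n)

*-identityˡ : ∀ x → 1ℝ * x ≈ x
*-identityˡ x = pointwise λ n → ℚₚ.*-identityˡ (seq x n)

*-identityʳ : ∀ x → x * 1ℝ ≈ x
*-identityʳ x = pointwise λ n → ℚₚ.*-identityʳ (seq x n)

*-distribˡ-+ : ∀ x y z → x * (y + z) ≈ x * y + x * z
*-distribˡ-+ x y z = pointwise λ n → ℚₚ.*-distribˡ-+ (seq x n) (seq y n) (seq z n)

*-distribʳ-+ : ∀ x y z → (y + z) * x ≈ y * x + z * x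
*-distribʳ-+ x y z = pointwise λ n → ℚₚ.*-distribʳ-+ (seq x n) (seq y n) (seq z n)

ℝ-commutativeRing : CommutativeRing 0ℓ 0ℓ
ℝ-commutativeRing = record
  { Carrier = ℝ ; _≈_ = _≈_ ; _+_ = _+_ ; _*_ = _*_ ; -_ = -_ ; 0# = 0ℝ ; 1# = 1ℝ
  ; isCommutativeRing = record
    { isRing = record
      { +-isAbelianGroup = record
        { isGroup = record
          { isMonoid = record
            { isSemigroup = record
              { isMagma = record { isEquivalence = ≈-isEquivalence ; ∙-cong = +-cong }
              ; assoc   = +-assoc
              }
            ; identity = +-identityˡ , +-identityʳ
            }
          ; inverse = -‿inverseˡ , -‿inverseʳ
          ; ⁻¹-cong = -‿cong
          }
        ; comm = +-comm
        }
      ; *-cong     = *-cong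
      ; *-assoc    = *-assoc
      ; *-identity = *-identityˡ , *-identityʳ
      ; distrib    = *-distribˡ-+ , *-distribʳ-+
      }
    ; *-comm = *-comm
    }
  }

-- In particular x ^ 0 is 1ℝ for every x, including 0ℝ.
open import Algebra.Definitions.RawSemiring (Semiring.rawSemiring (CommutativeRing.semiring ℝ-commutativeRing)) public
  using (_^_; sum; product)

------------------------------------------------------------------------
-- Partial exponential Bell polynomials

tuples : ∀ m → List ℕ → List (Vec ℕ m)
tuples zero    xs = [] ∷ []
tuples (suc m) xs = cartesianProductWith _∷_ xs (tuples m xs)

-- k₁ + 2 k₂ + ⋯ + m kₘ; position i : Fin m stands for the index j = 1 + i.
weight : ∀ {m} → Vec ℕ m → ℕ
weight v = Vec.sum (Vec.tabulate λ i → suc (toℕ i) ℕ.* Vec.lookup v i)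

InΛ : ∀ n k → Vec ℕ (suc (n ∸ k)) → Set
InΛ n k v = Vec.sum v ≡ k × weight v ≡ n

inΛ? : ∀ n k → Decidable (InΛ n k)
inΛ? n k v = (Vec.sum v ℕₚ.≟ k) ×-dec (weight v ℕₚ.≟ n)

-- Entries of a vector with sum k are at most k, so searching {0,…,k} suffices;
-- see ∈Λ⇔InΛ and Λ-unique.
Λ : ∀ n k → List (Vec ℕ (suc (n ∸ k)))
Λ n k = filter (inΛ? n k) (tuples (suc (n ∸ k)) (upTo (suc k)))

∈-tuples : ∀ {m} b (v : Vec ℕ m) → Vec.sum v ℕ.≤ b → v ∈ tuples m (upTo (suc b))
∈-tuples b []      _ = here refl
∈-tuples b (a ∷ v) h = ∈-cartesianProductWith⁺ _∷_
  (∈-upTo⁺ (s≤s (ℕₚ.m+n≤o⇒m≤o a h))) (∈-tuples b v (ℕₚ.m+n≤o⇒n≤o a h))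

∈Λ⇔InΛ : ∀ n k v → v ∈ Λ n k ⇔ InΛ n k v
∈Λ⇔InΛ n k v = mk⇔
  (λ v∈Λ → proj₂ (∈-filter⁻ (inΛ? n k) {xs = tuples (suc (n ∸ k)) (upTo (suc k))} v∈Λ))
  (λ p → ∈-filter⁺ (inΛ? n k) (∈-tuples k v (ℕₚ.≤-reflexive (proj₁ p))) p)

tuples-unique : ∀ m {xs} → Unique xs → Unique (tuples m xs)
tuples-unique zero    _  = [] ∷ []
tuples-unique (suc m) ux = cartesianProductWith⁺ _∷_ ∷-injective ux (tuples-unique m ux)

Λ-unique : ∀ n k → Unique (Λ n k)
Λ-unique n k = filter⁺ (inΛ? n k) (tuples-unique (suc (n ∸ k)) (upTo⁺ (suc k)))

1/_! : ℕ → ℝ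
1/ n ! = fromℚ ((+ 1 ℚ./ (n !)) {{n ℕₚ.!≢0}})

bellTerm : ∀ {m} → Vector ℝ m → Vec ℕ m → ℝ
bellTerm x v = product λ i →
  1/ Vec.lookup v i ! * (x i * 1/ suc (toℕ i) !) ^ Vec.lookup v i

-- The variable xⱼ is x i with j = 1 + toℕ i, for 1 ≤ j ≤ n - k + 1.  Meaningful for 1 ≤ k ≤ n.
B : ∀ n k → Vector ℝ (suc (n ∸ k)) → ℝ
B n k x = fromℕ (n !) * foldr _+_ 0ℝ (List.map (bellTerm x) (Λ n k))

{-# OPTIONS --safe #-}

-- Absorbing (-β)^k into the arguments of the Bell polynomial turns the j-th argument divided
-- by j! into uⱼ = z^j / j with z = -αβ.  The sum over k and Λ n k then is n! times the
-- coefficient cₙ of x^n in exp (Σ uⱼ x^j) = 1 / (1 - z x).  That coefficient is found from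
-- Euler's relation n cₙ = Σ_{j ≤ n} j uⱼ cₙ₋ⱼ = Σ_{j ≤ n} z^j cₙ₋ⱼ: subtracting z times the
-- relation for n from the one for n + 1 leaves (n + 1) cₙ₊₁ = (n + 1) z cₙ.
--
-- Infinite sums and truncated subtraction are avoided by replacing coefficient extraction with
-- arbitrary test functions Φ of (Σ vⱼ, Σ j vⱼ), summed over the multiplicities v in a finite box.

module Submission where

open import Defs
open import Algebra.Bundles using (CommutativeRing)
open import Data.Bool.Base using (Bool; true; false; _∧_)
open import Data.Empty using (⊥)
open import Data.Fin.Base using (zero; suc; toℕ)
open import Data.Fin.Properties using (toℕ<n)
open import Data.Integer.Base as ℤ using (+_)
import Data.Integer.Properties as ℤₚ
open import Data.List.Base as List
  using (List; []; _∷_; _++_; foldr; filter; applyUpTo; upTo; cartesianProductWith)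
open import Data.List.Properties using (map-∘)
open import Data.Nat.Base as ℕ using (_≤′_; ≤′-refl; ≤′-step; ℕ; zero; suc; _≤_; _<_; _∸_; _≡ᵇ_; z≤n; s≤s; _!)
import Data.Nat.Properties as ℕₚ
open ℕₚ using (≤⇒≤′; ≤′⇒≤)
open import Data.Product.Base using (_×_; _,_; proj₁)
open import Data.Rational.Base as ℚ using (ℚ)
import Data.Rational.Properties as ℚₚ
open import Data.Rational.Unnormalised.Base as ℚᵘ using (mkℚᵘ)
import Data.Rational.Unnormalised.Properties as ℚᵘₚ
open import Data.Vec.Base as Vec using (Vec; []; _∷_; lookup; tabulate)
open import Function.Base using (_∘_; id)
open import Relation.Binary.PropositionalEquality as ≡ using (_≡_; refl; cong; cong₂)
open import Relation.Nullary.Decidable using (does; yes; no)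
open import Relation.Nullary.Negation using (contradiction)
open import Relation.Unary using (Decidable)

open CommutativeRing ℝ-commutativeRing
  using (setoid; semiring; commutativeSemiring; zeroˡ; zeroʳ; ring)
  renaming (refl to ≈-refl; sym to ≈-sym; trans to ≈-trans; reflexive to ≈-reflexive)
open import Algebra.Properties.Semiring.Sum semiring
  using (sum-cong-≋; ∑-distrib-+; ∑-comm; *-distribˡ-sum)
open import Algebra.Properties.Semiring.Exp semiring using (^-homo-*; ^-congˡ)
open import Algebra.Properties.CommutativeSemiring.Exp commutativeSemiring using (^-distrib-*)
open import Algebra.Properties.Ring ring using (-1*x≈-x)
open import Algebra.Solver.Ring.NaturalCoefficients.Default commutativeSemiring
  using (solve; _:=_; _:+_; _:*_; con)
open import Relation.Binary.Reasoning.Setoid setoid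

*-congˡ : ∀ {x y z} → y ≈ z → x * y ≈ x * z
*-congˡ = *-cong ≈-refl

*-congʳ : ∀ {x y z} → y ≈ z → y * x ≈ z * x
*-congʳ p = *-cong p ≈-refl

-- Embedding of the naturals and inverse factorials

private
  ℕ→ℚ : ℕ → ℚ
  ℕ→ℚ n = + n ℚ./ 1

  -- Unnormalised rationals bypass the gcd reduction hidden in `ℚ./`; there the identities below
  -- become cross-multiplications of integers.
  toℚᵘ-/ : ∀ n d → ℚ.toℚᵘ (+ n ℚ./ suc d) ℚᵘ.≃ mkℚᵘ (+ n) d
  toℚᵘ-/ n d = ℚₚ.toℚᵘ-fromℚᵘ (mkℚᵘ (+ n) d)

  ℕ→ℚ-homo-+ : ∀ m n → ℕ→ℚ (m ℕ.+ n) ≡ ℕ→ℚ m ℚ.+ ℕ→ℚ n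
  ℕ→ℚ-homo-+ m n = ℚₚ.toℚᵘ-injective (ℚᵘₚ.≃-trans (toℚᵘ-/ (m ℕ.+ n) 0) (ℚᵘₚ.≃-sym
    (ℚᵘₚ.≃-trans (ℚₚ.toℚᵘ-homo-+ (ℕ→ℚ m) (ℕ→ℚ n))
    (ℚᵘₚ.≃-trans (ℚᵘₚ.+-cong (toℚᵘ-/ m 0) (toℚᵘ-/ n 0))
      (ℚᵘ.*≡* (cong (ℤ._* + 1) (cong₂ ℤ._+_ (ℤₚ.*-identityʳ (+ m)) (ℤₚ.*-identityʳ (+ n)))))))))

  ℕ→ℚ-homo-* : ∀ m n → ℕ→ℚ (m ℕ.* n) ≡ ℕ→ℚ m ℚ.* ℕ→ℚ n
  ℕ→ℚ-homo-* m n = ℚₚ.toℚᵘ-injective (ℚᵘₚ.≃-trans (toℚᵘ-/ (m ℕ.* n) 0) (ℚᵘₚ.≃-sym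
    (ℚᵘₚ.≃-trans (ℚₚ.toℚᵘ-homo-* (ℕ→ℚ m) (ℕ→ℚ n))
    (ℚᵘₚ.≃-trans (ℚᵘₚ.*-cong (toℚᵘ-/ m 0) (toℚᵘ-/ n 0))
      (ℚᵘ.*≡* (cong (ℤ._* + 1) (≡.sym (ℤₚ.pos-* m n))))))))

  n*1/n≡1 : ∀ n .{{_ : ℕ.NonZero n}} → ℕ→ℚ n ℚ.* (+ 1 ℚ./ n) ≡ ℚ.1ℚ
  n*1/n≡1 (suc d) = ℚₚ.toℚᵘ-injective
    (ℚᵘₚ.≃-trans (ℚₚ.toℚᵘ-homo-* (ℕ→ℚ (suc d)) (+ 1 ℚ./ suc d))
    (ℚᵘₚ.≃-trans (ℚᵘₚ.*-cong (toℚᵘ-/ (suc d) 0) (toℚᵘ-/ 1 d))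
      (ℚᵘ.*≡* (≡.trans (ℤₚ.*-identityʳ _) (≡.trans (ℤₚ.*-comm (+ suc d) (+ 1))
        (cong (+ 1 ℤ.*_) (≡.sym (ℤₚ.*-identityˡ (+ suc d)))))))))

fromℕ-homo-+ : ∀ m n → fromℕ (m ℕ.+ n) ≈ fromℕ m + fromℕ n
fromℕ-homo-+ m n = pointwise λ _ → ℕ→ℚ-homo-+ m n

fromℕ-homo-* : ∀ m n → fromℕ (m ℕ.* n) ≈ fromℕ m * fromℕ n
fromℕ-homo-* m n = pointwise λ _ → ℕ→ℚ-homo-* m n

n!*1/n!≈1 : ∀ n → fromℕ (n !) * 1/ n ! ≈ 1ℝ
n!*1/n!≈1 n = pointwise λ _ → n*1/n≡1 (n !) {{n ℕₚ.!≢0}}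

1/0!≈1 : 1/ 0 ! ≈ 1ℝ
1/0!≈1 = pointwise λ _ → refl

[1+n]*n!*1/[1+n]!≈1 : ∀ n → fromℕ (suc n) * fromℕ (n !) * 1/ suc n ! ≈ 1ℝ
[1+n]*n!*1/[1+n]!≈1 n =
  ≈-trans (*-congʳ (≈-sym (fromℕ-homo-* (suc n) (n !)))) (n!*1/n!≈1 (suc n))

[1+n]*1/[1+n]!≈1/n! : ∀ n → fromℕ (suc n) * 1/ suc n ! ≈ 1/ n !
[1+n]*1/[1+n]!≈1/n! n = begin
  fromℕ (suc n) * 1/ suc n !                              ≈⟨ *-identityʳ _ ⟨
  -- The unit is expanded as `fromℕ (n !) * 1/ n !` so that `suc n` and `n !` combine to cancel
  -- `1/ suc n !`.
  fromℕ (suc n) * 1/ suc n ! * 1ℝ                         ≈⟨ *-congˡ (n!*1/n!≈1 n) ⟨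
  fromℕ (suc n) * 1/ suc n ! * (fromℕ (n !) * 1/ n !)
    ≈⟨ solve 4 (λ a b c d → a :* b :* (c :* d) := a :* c :* b :* d) ≈-refl
         (fromℕ (suc n)) (1/ suc n !) (fromℕ (n !)) (1/ n !) ⟩
  fromℕ (suc n) * fromℕ (n !) * 1/ suc n ! * 1/ n !       ≈⟨ *-congʳ ([1+n]*n!*1/[1+n]!≈1 n) ⟩
  1ℝ * 1/ n !                                             ≈⟨ *-identityˡ _ ⟩
  1/ n !                                                  ∎

fromℕ-suc-cancelˡ : ∀ n {x y} → fromℕ (suc n) * x ≈ fromℕ (suc n) * y → x ≈ y
fromℕ-suc-cancelˡ n {x} {y} nx≈ny = ≈-trans (≈-sym (undo x)) (≈-trans (*-congˡ nx≈ny) (undo y))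
  where
  -- The reciprocal of `n + 1`, obtained from the inverse factorials as `n! / (n + 1)!`.
  1/n : ℝ
  1/n = fromℕ (n !) * 1/ suc n !
  undo : ∀ z → 1/n * (fromℕ (suc n) * z) ≈ z
  undo z = begin
    1/n * (fromℕ (suc n) * z)
      ≈⟨ solve 4 (λ a b c d → a :* b :* (c :* d) := c :* a :* b :* d) ≈-refl
           (fromℕ (n !)) (1/ suc n !) (fromℕ (suc n)) z ⟩
    fromℕ (suc n) * fromℕ (n !) * 1/ suc n ! * z  ≈⟨ *-congʳ ([1+n]*n!*1/[1+n]!≈1 n) ⟩
    1ℝ * z                                        ≈⟨ *-identityˡ z ⟩
    z                                             ∎

-- Sums over an initial segment of ℕ

∑ : ℕ → (ℕ → ℝ) → ℝ
∑ n f = sum {n} (λ i → f (toℕ i))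

∑-cong : ∀ n {f g : ℕ → ℝ} → (∀ i → i < n → f i ≈ g i) → ∑ n f ≈ ∑ n g
∑-cong n f≈g = sum-cong-≋ {n} λ i → f≈g (toℕ i) (toℕ<n i)

∑-zero : ∀ n {f : ℕ → ℝ} → (∀ i → f i ≈ 0ℝ) → ∑ n f ≈ 0ℝ
∑-zero zero    f≈0 = ≈-refl
∑-zero (suc n) f≈0 = ≈-trans (+-cong (f≈0 0) (∑-zero n (f≈0 ∘ suc))) (+-identityˡ 0ℝ)

∑-+ : ∀ n (f g : ℕ → ℝ) → ∑ n (λ i → f i + g i) ≈ ∑ n f + ∑ n g
∑-+ n f g = ∑-distrib-+ {n} (f ∘ toℕ) (g ∘ toℕ)

∑-*ˡ : ∀ n x (f : ℕ → ℝ) → x * ∑ n f ≈ ∑ n (λ i → x * f i)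
∑-*ˡ n x f = *-distribˡ-sum {n} x (f ∘ toℕ)

∑-swap : ∀ m n (f : ℕ → ℕ → ℝ) → ∑ m (λ i → ∑ n (f i)) ≈ ∑ n (λ j → ∑ m (λ i → f i j))
∑-swap m n f = ∑-comm {m} {n} (λ i j → f (toℕ i) (toℕ j))

∑-last : ∀ n (f : ℕ → ℝ) → ∑ (suc n) f ≈ ∑ n f + f n
∑-last zero    f = +-comm (f 0) 0ℝ
∑-last (suc n) f = ≈-trans (+-cong ≈-refl (∑-last n (f ∘ suc))) (≈-sym (+-assoc _ _ _))

∑-head : ∀ n (f : ℕ → ℝ) → (∀ i → f (suc i) ≈ 0ℝ) → ∑ (suc n) f ≈ f 0
∑-head n f f≈0 = ≈-trans (+-cong ≈-refl (∑-zero n f≈0)) (+-identityʳ (f 0))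

∑-init : ∀ n (f : ℕ → ℝ) → f n ≈ 0ℝ → ∑ (suc n) f ≈ ∑ n f
∑-init n f fn≈0 = ≈-trans (∑-last n f) (≈-trans (+-cong ≈-refl fn≈0) (+-identityʳ _))

-- Serves the substitution `a ↦ a + 1` in a truncated sum: a vanishing first term on one side pays
-- for a vanishing last term on the other.
∑-reindex : ∀ n (f g : ℕ → ℝ) → f 0 ≈ 0ℝ → g n ≈ 0ℝ → (∀ i → f (suc i) ≈ g i) →
  ∑ (suc n) f ≈ ∑ (suc n) g
∑-reindex n f g f0≈0 gn≈0 f≈g = begin
  f 0 + ∑ n (f ∘ suc)  ≈⟨ +-cong f0≈0 (∑-cong n λ i _ → f≈g i) ⟩
  0ℝ + ∑ n g           ≈⟨ +-identityˡ _ ⟩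
  ∑ n g                ≈⟨ ∑-init n g gn≈0 ⟨
  ∑ (suc n) g          ∎

-- Indicators

⟦_⟧ : Bool → ℝ
⟦ true  ⟧ = 1ℝ
⟦ false ⟧ = 0ℝ

⟦∧⟧ : ∀ p q → ⟦ p ∧ q ⟧ ≈ ⟦ p ⟧ * ⟦ q ⟧
⟦∧⟧ true  q = ≈-sym (*-identityˡ ⟦ q ⟧)
⟦∧⟧ false q = ≈-sym (zeroˡ ⟦ q ⟧)

≢⇒⟦≡ᵇ⟧ : ∀ m n → (m ≡ n → ⊥) → ⟦ m ≡ᵇ n ⟧ ≈ 0ℝ
≢⇒⟦≡ᵇ⟧ zero    zero    m≢n = contradiction refl m≢n
≢⇒⟦≡ᵇ⟧ zero    (suc n) m≢n = ≈-refl
≢⇒⟦≡ᵇ⟧ (suc m) zero    m≢n = ≈-refl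
≢⇒⟦≡ᵇ⟧ (suc m) (suc n) m≢n = ≢⇒⟦≡ᵇ⟧ m n (m≢n ∘ cong suc)

∑⟦≡ᵇ⟧ : ∀ n s → s < n → ∑ n (λ k → ⟦ s ≡ᵇ k ⟧) ≈ 1ℝ
∑⟦≡ᵇ⟧ (suc n) zero    _         = ∑-head n (λ k → ⟦ 0 ≡ᵇ k ⟧) (λ _ → ≈-refl)
∑⟦≡ᵇ⟧ (suc n) (suc s) (s≤s s<n) = ≈-trans (+-identityˡ _) (∑⟦≡ᵇ⟧ n s s<n)

-- The exponential generating functional

infix 4 _⊴_

-- What is used of the pairs s = Σ vⱼ and w = Σ (1 + eⱼ) vⱼ.
_⊴_ : ℕ → ℕ → Set
s ⊴ w = s ≤ w × (s ≡ 0 → w ≡ 0)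

-- Prepending an entry `a` of weight `suc c` adds at least as much to the weight as to the sum, and
-- a zero sum forces `a` to be 0. Inductions over the variables carry the relation through this.
⊴-shift : ∀ c a {s w} → s ⊴ w → a ℕ.+ s ⊴ suc c ℕ.* a ℕ.+ w
⊴-shift c a (s≤w , s≡0⇒w≡0) =
    ℕₚ.+-mono-≤ (ℕₚ.m≤m+n a (c ℕ.* a)) s≤w
  , λ a+s≡0 → cong₂ ℕ._+_
      (≡.trans (cong (suc c ℕ.*_) (ℕₚ.m+n≡0⇒m≡0 a a+s≡0)) (ℕₚ.*-zeroʳ (suc c)))
      (s≡0⇒w≡0 (ℕₚ.m+n≡0⇒n≡0 a a+s≡0))

-- The test function seen by the remaining variables once a variable of weight `suc c` has been
-- given the entry `a`.
shift : ℕ → ℕ → (ℕ → ℕ → ℝ) → ℕ → ℕ → ℝ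
shift c a Φ s w = Φ (a ℕ.+ s) (suc c ℕ.* a ℕ.+ w)

-- Lets a unit step in a later variable, of weight `d`, pass the entry already fixed in the first
-- one.
shift-comm : ∀ c a d Φ s w →
  shift c a Φ (suc s) (d ℕ.+ w) ≡ shift c a (λ s′ w′ → Φ (suc s′) (d ℕ.+ w′)) s w
shift-comm c a d Φ s w = cong₂ Φ (ℕₚ.+-suc a s)
  (≡.trans (≡.sym (ℕₚ.+-assoc (suc c ℕ.* a) d w))
  (≡.trans (cong (ℕ._+ w) (ℕₚ.+-comm (suc c ℕ.* a) d)) (ℕₚ.+-assoc d (suc c ℕ.* a) w)))

shift-suc : ∀ c a Φ s w →
  shift c (suc a) Φ s w ≡ shift c a (λ s′ w′ → Φ (suc s′) (suc c ℕ.+ w′)) s w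
shift-suc c a Φ s w = cong (Φ (suc a ℕ.+ s))
  (≡.trans (cong (ℕ._+ w) (ℕₚ.*-suc (suc c) a)) (ℕₚ.+-assoc (suc c) (suc c ℕ.* a) w))

divPow : ℝ → ℕ → ℝ
divPow x a = 1/ a ! * x ^ a

-- Z b u e m Φ = Σ Φ (Σ vⱼ) (Σ (1 + eⱼ) vⱼ) ∏ uⱼ^vⱼ / vⱼ!  over v ∈ {0,…,b}^m.
Z : ℕ → (ℕ → ℝ) → (ℕ → ℕ) → ℕ → (ℕ → ℕ → ℝ) → ℝ
Z b u e zero    Φ = Φ 0 0
Z b u e (suc m) Φ =
  ∑ (suc b) λ a → divPow (u 0) a * Z b (u ∘ suc) (e ∘ suc) m (shift (e 0) a Φ)

-- Only pairs with `s ⊴ w` arise from vectors, so agreement on those suffices. This is how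
-- constraints on the sum and constraints on the weight get exchanged later.
Z-cong : ∀ b u e m {Φ Ψ} → (∀ s w → s ⊴ w → Φ s w ≈ Ψ s w) → Z b u e m Φ ≈ Z b u e m Ψ
Z-cong b u e zero    Φ≈Ψ = Φ≈Ψ 0 0 (z≤n , id)
Z-cong b u e (suc m) {Φ} {Ψ} Φ≈Ψ = ∑-cong (suc b) {summand Φ} {summand Ψ} λ a _ → *-congˡ
  (Z-cong b (u ∘ suc) (e ∘ suc) m λ s w s⊴w → Φ≈Ψ _ _ (⊴-shift (e 0) a s⊴w))
  where
  summand : (ℕ → ℕ → ℝ) → ℕ → ℝ
  summand Θ a = divPow (u 0) a * Z b (u ∘ suc) (e ∘ suc) m (shift (e 0) a Θ)

Z-*ˡ : ∀ b u e m x Φ → x * Z b u e m Φ ≈ Z b u e m (λ s w → x * Φ s w)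
Z-*ˡ b u e zero    x Φ = ≈-refl
Z-*ˡ b u e (suc m) x Φ = ≈-trans (∑-*ˡ (suc b) x λ a → divPow (u 0) a * Z′ a) (∑-cong (suc b) λ a _ → begin
  x * (divPow (u 0) a * Z′ a)
    ≈⟨ solve 3 (λ x c z → x :* (c :* z) := c :* (x :* z)) ≈-refl
         x (divPow (u 0) a) (Z′ a) ⟩
  divPow (u 0) a * (x * Z′ a)   ≈⟨ *-congˡ (Z-*ˡ b (u ∘ suc) (e ∘ suc) m x (shift (e 0) a Φ)) ⟩
  divPow (u 0) a * Z b (u ∘ suc) (e ∘ suc) m (λ s w → x * shift (e 0) a Φ s w) ∎)
  where
  Z′ : ℕ → ℝ
  Z′ a = Z b (u ∘ suc) (e ∘ suc) m (shift (e 0) a Φ)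

Z-+ : ∀ b u e m Φ Ψ → Z b u e m (λ s w → Φ s w + Ψ s w) ≈ Z b u e m Φ + Z b u e m Ψ
Z-+ b u e zero    Φ Ψ = ≈-refl
Z-+ b u e (suc m) Φ Ψ = ≈-trans
  (∑-cong (suc b) λ a _ → ≈-trans
    (*-congˡ (Z-+ b (u ∘ suc) (e ∘ suc) m (shift (e 0) a Φ) (shift (e 0) a Ψ)))
    (*-distribˡ-+ (divPow (u 0) a) (Z′ Φ a) (Z′ Ψ a)))
  (∑-+ (suc b) (λ a → divPow (u 0) a * Z′ Φ a) (λ a → divPow (u 0) a * Z′ Ψ a))
  where
  Z′ : (ℕ → ℕ → ℝ) → ℕ → ℝ
  Z′ Θ a = Z b (u ∘ suc) (e ∘ suc) m (shift (e 0) a Θ)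

Z-zero : ∀ b u e m {Φ} → (∀ s w → s ⊴ w → Φ s w ≈ 0ℝ) → Z b u e m Φ ≈ 0ℝ
Z-zero b u e zero    Φ≈0 = Φ≈0 0 0 (z≤n , id)
Z-zero b u e (suc m) {Φ} Φ≈0 = ∑-zero (suc b)
  {λ a → divPow (u 0) a * Z b (u ∘ suc) (e ∘ suc) m (shift (e 0) a Φ)} λ a → ≈-trans
  (*-congˡ (Z-zero b (u ∘ suc) (e ∘ suc) m λ s w s⊴w → Φ≈0 _ _ (⊴-shift (e 0) a s⊴w)))
  (zeroʳ (divPow (u 0) a))

Z-∑ : ∀ b u e m n (Φ : ℕ → ℕ → ℕ → ℝ) →
  ∑ n (λ k → Z b u e m (Φ k)) ≈ Z b u e m (λ s w → ∑ n λ k → Φ k s w)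
Z-∑ b u e m zero    Φ = ≈-sym (Z-zero b u e m λ _ _ _ → ≈-refl)
Z-∑ b u e m (suc n) Φ = ≈-trans (+-cong ≈-refl (Z-∑ b u e m n (Φ ∘ suc))) (≈-sym (Z-+ b u e m _ _))

divPow-0 : ∀ x y → divPow x 0 * y ≈ y
divPow-0 x y = ≈-trans (*-congʳ (≈-trans (*-congʳ 1/0!≈1) (*-identityˡ 1ℝ))) (*-identityˡ y)

divPow-suc : ∀ x a → fromℕ (suc a) * divPow x (suc a) ≈ x * divPow x a
divPow-suc x a = begin
  fromℕ (suc a) * (1/ suc a ! * (x * x ^ a))
    ≈⟨ solve 4 (λ n f x p → n :* (f :* (x :* p)) := n :* f :* (x :* p)) ≈-refl
         (fromℕ (suc a)) (1/ suc a !) x (x ^ a) ⟩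
  fromℕ (suc a) * 1/ suc a ! * (x * x ^ a)  ≈⟨ *-congʳ ([1+n]*1/[1+n]!≈1/n! a) ⟩
  1/ a ! * (x * x ^ a)
    ≈⟨ solve 3 (λ f x p → f :* (x :* p) := x :* (f :* p)) ≈-refl (1/ a !) x (x ^ a) ⟩
  x * (1/ a ! * x ^ a)                      ∎

-- No entry exceeds the sum of all entries, so for such `Φ` the box `{0,…,b}^m` already contains
-- every vector that contributes.
SupportedBelow : ℕ → (ℕ → ℕ → ℝ) → Set
SupportedBelow b Φ = ∀ s w → s ⊴ w → b < s → Φ s w ≈ 0ℝ

shift-supported : ∀ {b Φ} c a → SupportedBelow b Φ → SupportedBelow b (shift c a Φ)
shift-supported c a supp s w s⊴w b<s =
  supp _ _ (⊴-shift c a s⊴w) (ℕₚ.<-≤-trans b<s (ℕₚ.m≤n+m s a))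

-- Differentiating the exponential generating function: vⱼ uⱼ^vⱼ / vⱼ! = uⱼ uⱼ^(vⱼ-1) / (vⱼ-1)!.
Z-euler : ∀ b u e m Φ → SupportedBelow b Φ →
  Z b u e m (λ s w → fromℕ w * Φ s w) ≈
  ∑ m (λ j → fromℕ (suc (e j)) * u j * Z b u e m (λ s w → Φ (suc s) (suc (e j) ℕ.+ w)))
Z-euler b u e zero    Φ supp = zeroˡ (Φ 0 0)
Z-euler b u e (suc m) Φ supp = begin
  ∑ (suc b) (λ a → d a * Z′ (λ s w → fromℕ (c a ℕ.+ w) * shift (e 0) a Φ s w))
    -- Product rule: the weight of `a ∷ v` is `c a` plus the weight of `v`, which separates the
    -- first variable from the others, where the induction applies.
    ≈⟨ ∑-cong (suc b) (λ a _ → split a) ⟩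
  ∑ (suc b) (λ a → d a * (fromℕ (c a) * S a) + d a * T a)
    ≈⟨ ∑-+ (suc b) (λ a → d a * (fromℕ (c a) * S a)) (λ a → d a * T a) ⟩
  ∑ (suc b) (λ a → d a * (fromℕ (c a) * S a)) + ∑ (suc b) (λ a → d a * T a)
    ≈⟨ +-cong head-part tail-part ⟩
  fromℕ (suc (e 0)) * u 0 * ∑ (suc b) (λ a → d a * S′ a)
    + ∑ m (λ j → k j * ∑ (suc b) (λ a → d a * Z′ (shift (e 0) a (Φ′ j)))) ∎
  where
  Z′ : (ℕ → ℕ → ℝ) → ℝ
  Z′ = Z b (u ∘ suc) (e ∘ suc) m
  d : ℕ → ℝ
  d = divPow (u 0)
  c : ℕ → ℕ
  c a = suc (e 0) ℕ.* a
  S S′ : ℕ → ℝ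
  S a = Z′ (shift (e 0) a Φ)
  S′ a = Z′ (shift (e 0) a λ s w → Φ (suc s) (suc (e 0) ℕ.+ w))
  k : ℕ → ℝ
  k j = fromℕ (suc (e (suc j))) * u (suc j)
  Φ′ : ℕ → ℕ → ℕ → ℝ
  Φ′ j s w = Φ (suc s) (suc (e (suc j)) ℕ.+ w)
  U : ℕ → ℕ → ℝ
  U a j = k j * Z′ (λ s w → shift (e 0) a Φ (suc s) (suc (e (suc j)) ℕ.+ w))
  T : ℕ → ℝ
  T a = ∑ m (U a)

  split : ∀ a → d a * Z′ (λ s w → fromℕ (c a ℕ.+ w) * shift (e 0) a Φ s w) ≈
                d a * (fromℕ (c a) * S a) + d a * T a
  split a = ≈-trans (*-congˡ (begin
    Z′ (λ s w → fromℕ (c a ℕ.+ w) * shift (e 0) a Φ s w)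
      ≈⟨ Z-cong b _ _ m (λ s w _ → ≈-trans (*-congʳ (fromℕ-homo-+ (c a) w))
           (*-distribʳ-+ (shift (e 0) a Φ s w) (fromℕ (c a)) (fromℕ w))) ⟩
    Z′ (λ s w → fromℕ (c a) * shift (e 0) a Φ s w + fromℕ w * shift (e 0) a Φ s w)
      ≈⟨ Z-+ b _ _ m _ _ ⟩
    Z′ (λ s w → fromℕ (c a) * shift (e 0) a Φ s w) + Z′ (λ s w → fromℕ w * shift (e 0) a Φ s w)
      ≈⟨ +-cong (≈-sym (Z-*ˡ b _ _ m (fromℕ (c a)) (shift (e 0) a Φ)))
           (Z-euler b (u ∘ suc) (e ∘ suc) m (shift (e 0) a Φ) (shift-supported (e 0) a supp)) ⟩
    fromℕ (c a) * S a + T a ∎))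
    (*-distribˡ-+ (d a) (fromℕ (c a) * S a) (T a))

  S-suc : ∀ a → S (suc a) ≈ S′ a
  S-suc a = Z-cong b _ _ m λ s w _ → ≈-reflexive (shift-suc (e 0) a Φ s w)

  S-last : S (suc b) ≈ 0ℝ
  S-last = Z-zero b _ _ m λ s w s⊴w →
    supp _ _ (⊴-shift (e 0) (suc b) s⊴w) (ℕₚ.m≤m+n (suc b) s)

  head-part : ∑ (suc b) (λ a → d a * (fromℕ (c a) * S a)) ≈
              fromℕ (suc (e 0)) * u 0 * ∑ (suc b) (λ a → d a * S′ a)
  head-part = ≈-trans
    (∑-reindex b (λ a → d a * (fromℕ (c a) * S a))
      (λ a → fromℕ (suc (e 0)) * u 0 * (d a * S′ a)) first last step)
    (≈-sym (∑-*ˡ (suc b) (fromℕ (suc (e 0)) * u 0) (λ a → d a * S′ a)))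
    where
    first : d 0 * (fromℕ (c 0) * S 0) ≈ 0ℝ
    first = ≈-trans (*-congˡ (≈-trans
      (*-congʳ (≈-reflexive (cong fromℕ (ℕₚ.*-zeroʳ (suc (e 0)))))) (zeroˡ (S 0)))) (zeroʳ (d 0))
    -- Raising the top entry `b` by one leaves the support, so cutting both sums off at `b` does no
    -- harm.
    last : fromℕ (suc (e 0)) * u 0 * (d b * S′ b) ≈ 0ℝ
    last = ≈-trans (*-congˡ (≈-trans (*-congˡ (≈-trans (≈-sym (S-suc b)) S-last)) (zeroʳ (d b))))
      (zeroʳ _)
    step : ∀ a → d (suc a) * (fromℕ (c (suc a)) * S (suc a)) ≈
                 fromℕ (suc (e 0)) * u 0 * (d a * S′ a)
    step a = begin
      d (suc a) * (fromℕ (c (suc a)) * S (suc a))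
        ≈⟨ *-congˡ (*-cong (fromℕ-homo-* (suc (e 0)) (suc a)) (S-suc a)) ⟩
      d (suc a) * (fromℕ (suc (e 0)) * fromℕ (suc a) * S′ a)
        ≈⟨ solve 4 (λ d e n s → d :* (e :* n :* s) := e :* (n :* d) :* s) ≈-refl
             (d (suc a)) (fromℕ (suc (e 0))) (fromℕ (suc a)) (S′ a) ⟩
      fromℕ (suc (e 0)) * (fromℕ (suc a) * d (suc a)) * S′ a
        ≈⟨ *-congʳ (*-congˡ (divPow-suc (u 0) a)) ⟩
      fromℕ (suc (e 0)) * (u 0 * d a) * S′ a
        ≈⟨ solve 4 (λ e x d s → e :* (x :* d) :* s := e :* x :* (d :* s)) ≈-refl
             (fromℕ (suc (e 0))) (u 0) (d a) (S′ a) ⟩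
      fromℕ (suc (e 0)) * u 0 * (d a * S′ a) ∎

  tail-part : ∑ (suc b) (λ a → d a * T a) ≈
              ∑ m (λ j → k j * ∑ (suc b) (λ a → d a * Z′ (shift (e 0) a (Φ′ j))))
  tail-part = begin
    ∑ (suc b) (λ a → d a * T a)
      ≈⟨ ∑-cong (suc b) (λ a _ → ≈-trans (∑-*ˡ m (d a) (U a)) (∑-cong m λ j _ → begin
           d a * (k j * Z′ (λ s w → shift (e 0) a Φ (suc s) (suc (e (suc j)) ℕ.+ w)))
             ≈⟨ *-congˡ (*-congˡ (Z-cong b _ _ m λ s w _ →
                  ≈-reflexive (shift-comm (e 0) a (suc (e (suc j))) Φ s w))) ⟩
           d a * (k j * Z′ (shift (e 0) a (Φ′ j)))
             ≈⟨ solve 3 (λ x y z → x :* (y :* z) := y :* (x :* z)) ≈-refl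
                  (d a) (k j) (Z′ (shift (e 0) a (Φ′ j))) ⟩
           k j * (d a * Z′ (shift (e 0) a (Φ′ j))) ∎)) ⟩
    ∑ (suc b) (λ a → ∑ m (λ j → k j * (d a * Z′ (shift (e 0) a (Φ′ j)))))
      ≈⟨ ∑-swap (suc b) m (λ a j → k j * (d a * Z′ (shift (e 0) a (Φ′ j)))) ⟩
    ∑ m (λ j → ∑ (suc b) (λ a → k j * (d a * Z′ (shift (e 0) a (Φ′ j)))))
      ≈⟨ ∑-cong m (λ j _ → ≈-sym (∑-*ˡ (suc b) (k j) (λ a → d a * Z′ (shift (e 0) a (Φ′ j))))) ⟩
    ∑ m (λ j → k j * ∑ (suc b) (λ a → d a * Z′ (shift (e 0) a (Φ′ j)))) ∎

-- Enlarging the box and adding variables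

Z-box-suc : ∀ b u e m Φ → SupportedBelow b Φ → Z b u e m Φ ≈ Z (suc b) u e m Φ
Z-box-suc b u e zero    Φ supp = ≈-refl
Z-box-suc b u e (suc m) Φ supp = begin
  ∑ (suc b) (summand b)
    ≈⟨ ∑-cong (suc b) {summand b} {summand (suc b)} (λ a _ → *-congˡ (Z-box-suc b (u ∘ suc) (e ∘ suc) m
         (shift (e 0) a Φ) (shift-supported (e 0) a supp))) ⟩
  ∑ (suc b) (summand (suc b))
    ≈⟨ ∑-init (suc b) (summand (suc b)) (≈-trans (*-congˡ (Z-zero (suc b) _ _ m λ s w s⊴w →
         supp _ _ (⊴-shift (e 0) (suc b) s⊴w) (ℕₚ.m≤m+n (suc b) s))) (zeroʳ (divPow (u 0) (suc b)))) ⟨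
  ∑ (suc (suc b)) (summand (suc b)) ∎
  where
  summand : ℕ → ℕ → ℝ
  summand b a = divPow (u 0) a * Z b (u ∘ suc) (e ∘ suc) m (shift (e 0) a Φ)

Z-box : ∀ {b b′} u e m Φ → b ≤′ b′ → SupportedBelow b Φ → Z b u e m Φ ≈ Z b′ u e m Φ
Z-box u e m Φ ≤′-refl               supp = ≈-refl
Z-box u e m Φ (≤′-step {b′} b≤′b′) supp = ≈-trans (Z-box u e m Φ b≤′b′ supp)
  (Z-box-suc b′ u e m Φ λ s w s⊴w b′<s → supp s w s⊴w (ℕₚ.≤-<-trans (≤′⇒≤ b≤′b′) b′<s))

-- The new variable is the last one, so the induction peels off the others first. A positive entry
-- in it leads to a value of `Φ` that the hypothesis kills; the entry 0 contributes the factor 1.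
Z-pad-suc : ∀ b u e m Φ → (∀ s w → s ⊴ w → Φ (suc s) (suc (e m) ℕ.+ w) ≈ 0ℝ) →
  Z b u e m Φ ≈ Z b u e (suc m) Φ
Z-pad-suc b u e zero Φ Φ≈0 = ≈-sym (begin
  ∑ (suc b) (λ a → divPow (u 0) a * shift (e 0) a Φ 0 0)
    ≈⟨ ∑-head b (λ a → divPow (u 0) a * shift (e 0) a Φ 0 0) (λ a → ≈-trans
         (*-congˡ (≈-trans (≈-reflexive (shift-suc (e 0) a Φ 0 0))
           (Φ≈0 _ _ (⊴-shift (e 0) a (z≤n , id)))))
         (zeroʳ (divPow (u 0) (suc a)))) ⟩
  divPow (u 0) 0 * shift (e 0) 0 Φ 0 0  ≈⟨ divPow-0 (u 0) _ ⟩
  Φ 0 (suc (e 0) ℕ.* 0 ℕ.+ 0)           ≈⟨ ≈-reflexive (cong (λ w → Φ 0 (w ℕ.+ 0)) (ℕₚ.*-zeroʳ (suc (e 0)))) ⟩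
  Φ 0 0                                 ∎)
Z-pad-suc b u e (suc m) Φ Φ≈0 = ∑-cong (suc b) {summand m} {summand (suc m)} λ a _ →
  *-congˡ (Z-pad-suc b (u ∘ suc) (e ∘ suc) m (shift (e 0) a Φ) λ s w s⊴w →
    ≈-trans (≈-reflexive (shift-comm (e 0) a (suc (e (suc m))) Φ s w))
      (Φ≈0 _ _ (⊴-shift (e 0) a s⊴w)))
  where
  summand : ℕ → ℕ → ℝ
  summand m a = divPow (u 0) a * Z b (u ∘ suc) (e ∘ suc) m (shift (e 0) a Φ)

Z-pad : ∀ {m m′} b u e Φ → m ≤′ m′ →
  (∀ j s w → m ≤ j → s ⊴ w → Φ (suc s) (suc (e j) ℕ.+ w) ≈ 0ℝ) →
  Z b u e m Φ ≈ Z b u e m′ Φ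
Z-pad b u e Φ ≤′-refl               Φ≈0 = ≈-refl
Z-pad b u e Φ (≤′-step {m′} m≤′m′) Φ≈0 = ≈-trans (Z-pad b u e Φ m≤′m′ Φ≈0)
  (Z-pad-suc b u e m′ Φ λ s w → Φ≈0 m′ s w (≤′⇒≤ m≤′m′))

-- Only the zero vector has sum 0, and its monomial is 1.
Z-origin : ∀ b u e m → Z b u e m (λ s _ → ⟦ s ≡ᵇ 0 ⟧) ≈ 1ℝ
Z-origin b u e zero    = ≈-refl
Z-origin b u e (suc m) = begin
  ∑ (suc b) summand
    ≈⟨ ∑-head b summand (λ a → ≈-trans (*-congˡ (Z-zero b _ _ m λ _ _ _ → ≈-refl))
         (zeroʳ (divPow (u 0) (suc a)))) ⟩
  summand 0                                             ≈⟨ divPow-0 (u 0) _ ⟩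
  Z b (u ∘ suc) (e ∘ suc) m (λ s _ → ⟦ s ≡ᵇ 0 ⟧)       ≈⟨ Z-origin b (u ∘ suc) (e ∘ suc) m ⟩
  1ℝ                                                    ∎
  where
  summand : ℕ → ℝ
  summand a = divPow (u 0) a * Z b (u ∘ suc) (e ∘ suc) m (shift (e 0) a λ s _ → ⟦ s ≡ᵇ 0 ⟧)

-- Coefficients of the geometric series

-- In degrees ≤ m + 1 this reads exp (Σ z^j x^j / j) = 1 / (1 - z x).
module _ (b m : ℕ) (u : ℕ → ℝ) (z : ℝ) (ju≈z^j : ∀ j → fromℕ (suc j) * u j ≈ z ^ suc j) where

  private
    coeff : ℕ → ℝ
    coeff n = Z b u id (suc m) (λ _ w → ⟦ w ≡ᵇ n ⟧)

    -- The coefficient of degree `n - (j + 1)`, written without subtraction: it is 0 when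
    -- `j + 1 > n`. By computation `shifted (suc n) 0` is `coeff n` and `shifted (suc n) (suc j)` is
    -- `shifted n j`.
    shifted : ℕ → ℕ → ℝ
    shifted n j = Z b u id (suc m) (λ _ w → ⟦ suc j ℕ.+ w ≡ᵇ n ⟧)

    term : ℕ → ℕ → ℝ
    term n j = z ^ suc j * shifted n j

    fromℕ-δ : ∀ n w → fromℕ n * ⟦ w ≡ᵇ n ⟧ ≈ fromℕ w * ⟦ w ≡ᵇ n ⟧
    fromℕ-δ n w with w ℕₚ.≟ n
    ... | yes refl = ≈-refl
    ... | no  w≢n  = ≈-trans (*-congˡ δ≈0) (≈-trans (zeroʳ (fromℕ n))
      (≈-sym (≈-trans (*-congˡ δ≈0) (zeroʳ (fromℕ w)))))
      where
      δ≈0 : ⟦ w ≡ᵇ n ⟧ ≈ 0ℝ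
      δ≈0 = ≢⇒⟦≡ᵇ⟧ w n w≢n

    coeff-euler : ∀ n → n ≤ b → fromℕ n * coeff n ≈ ∑ (suc m) (term n)
    coeff-euler n n≤b = begin
      fromℕ n * coeff n
        ≈⟨ Z-*ˡ b u id (suc m) (fromℕ n) (λ _ w → ⟦ w ≡ᵇ n ⟧) ⟩
      Z b u id (suc m) (λ _ w → fromℕ n * ⟦ w ≡ᵇ n ⟧)
        ≈⟨ Z-cong b u id (suc m) (λ _ w _ → fromℕ-δ n w) ⟩
      Z b u id (suc m) (λ _ w → fromℕ w * ⟦ w ≡ᵇ n ⟧)
        -- The support condition holds because `b < s` gives `w ≥ s > b ≥ n`.
        ≈⟨ Z-euler b u id (suc m) (λ _ w → ⟦ w ≡ᵇ n ⟧) (λ s w s⊴w b<s →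
             ≢⇒⟦≡ᵇ⟧ w n (ℕₚ.<⇒≢ (ℕₚ.≤-<-trans n≤b (ℕₚ.<-≤-trans b<s (proj₁ s⊴w))) ∘ ≡.sym)) ⟩
      ∑ (suc m) (λ j → fromℕ (suc j) * u j * shifted n j)
        ≈⟨ ∑-cong (suc m) {λ j → fromℕ (suc j) * u j * shifted n j} {term n} (λ j _ → *-congʳ (ju≈z^j j)) ⟩
      ∑ (suc m) (term n) ∎

    coeff-suc : ∀ n → n < b → n ≤ m → coeff (suc n) ≈ z * coeff n
    coeff-suc n n<b n≤m = fromℕ-suc-cancelˡ n (begin
      fromℕ (suc n) * coeff (suc n)
        ≈⟨ coeff-euler (suc n) n<b ⟩
      -- The terms after the first are `z` times the terms of the relation for `n`, one short of the
      -- full range.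
      z ^ 1 * coeff n + ∑ m (term (suc n) ∘ suc)
        ≈⟨ +-cong (*-congʳ (*-identityʳ z)) (begin
             ∑ m (term (suc n) ∘ suc)
               ≈⟨ ∑-cong m {term (suc n) ∘ suc} {λ j → z * term n j} (λ j _ →
                    *-assoc z (z ^ suc j) (shifted n j)) ⟩
             ∑ m (λ j → z * term n j)
               ≈⟨ ∑-*ˡ m z (term n) ⟨
             z * ∑ m (term n)
               ≈⟨ *-congˡ (∑-init m (term n) last≈0) ⟨
             z * ∑ (suc m) (term n)
               ≈⟨ *-congˡ (coeff-euler n (ℕₚ.<⇒≤ n<b)) ⟨
             z * (fromℕ n * coeff n) ∎) ⟩
      z * coeff n + z * (fromℕ n * coeff n)
        ≈⟨ solve 3 (λ z c n → z :* c :+ z :* (n :* c) := (con 1 :+ n) :* (z :* c)) ≈-refl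
             z (coeff n) (fromℕ n) ⟩
      (1ℝ + fromℕ n) * (z * coeff n)
        ≈⟨ *-congʳ (fromℕ-homo-+ 1 n) ⟨
      fromℕ (suc n) * (z * coeff n) ∎)
      where
      -- The missing term has `j + 1 = m + 1 > n`, beyond the degree `n`.
      last≈0 : term n m ≈ 0ℝ
      last≈0 = ≈-trans (*-congˡ (Z-zero b u id (suc m) λ _ w _ → ≢⇒⟦≡ᵇ⟧ (suc m ℕ.+ w) n
        (ℕₚ.<⇒≢ (ℕₚ.≤-<-trans n≤m (ℕₚ.m≤m+n (suc m) w)) ∘ ≡.sym))) (zeroʳ (z ^ suc m))

    -- On reachable pairs weight 0 and sum 0 are equivalent, which reduces the claim to `Z-origin`.
    coeff-zero : coeff 0 ≈ 1ℝ
    coeff-zero = ≈-trans (Z-cong b u id (suc m) δ) (Z-origin b u id (suc m))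
      where
      δ : ∀ s w → s ⊴ w → ⟦ w ≡ᵇ 0 ⟧ ≈ ⟦ s ≡ᵇ 0 ⟧
      δ zero    zero    _              = ≈-refl
      δ zero    (suc w) (_ , s≡0⇒w≡0) = contradiction (s≡0⇒w≡0 refl) λ ()
      δ (suc s) (suc w) _              = ≈-refl

  Z-geometric : ∀ n → n ≤ b → n ≤ suc m → Z b u id (suc m) (λ _ w → ⟦ w ≡ᵇ n ⟧) ≈ z ^ n
  Z-geometric zero    _   _         = coeff-zero
  Z-geometric (suc n) n<b (s≤s n≤m) = ≈-trans (coeff-suc n n<b n≤m)
    (*-congˡ (Z-geometric n (ℕₚ.<⇒≤ n<b) (ℕₚ.m≤n⇒m≤1+n n≤m)))

-- Sums over lists

∑ₗ : {A : Set} → (A → ℝ) → List A → ℝ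
∑ₗ f xs = foldr _+_ 0ℝ (List.map f xs)

module _ {A : Set} where

  ∑ₗ-cong : {f g : A → ℝ} → (∀ x → f x ≈ g x) → ∀ xs → ∑ₗ f xs ≈ ∑ₗ g xs
  ∑ₗ-cong f≈g []       = ≈-refl
  ∑ₗ-cong f≈g (x ∷ xs) = +-cong (f≈g x) (∑ₗ-cong f≈g xs)

  ∑ₗ-*ˡ : ∀ c (f : A → ℝ) xs → c * ∑ₗ f xs ≈ ∑ₗ (λ x → c * f x) xs
  ∑ₗ-*ˡ c f []       = zeroʳ c
  ∑ₗ-*ˡ c f (x ∷ xs) = ≈-trans (*-distribˡ-+ c (f x) _) (+-cong ≈-refl (∑ₗ-*ˡ c f xs))

  ∑ₗ-++ : ∀ (f : A → ℝ) xs ys → ∑ₗ f (xs ++ ys) ≈ ∑ₗ f xs + ∑ₗ f ys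
  ∑ₗ-++ f []       ys = ≈-sym (+-identityˡ _)
  ∑ₗ-++ f (x ∷ xs) ys = ≈-trans (+-cong ≈-refl (∑ₗ-++ f xs ys)) (≈-sym (+-assoc (f x) _ _))

  ∑ₗ-filter : ∀ {P : A → Set} (P? : Decidable P) (f : A → ℝ) xs →
    ∑ₗ f (filter P? xs) ≈ ∑ₗ (λ x → f x * ⟦ does (P? x) ⟧) xs
  ∑ₗ-filter P? f []       = ≈-refl
  ∑ₗ-filter P? f (x ∷ xs) with does (P? x)
  ... | false = ≈-trans (∑ₗ-filter P? f xs)
                  (≈-sym (≈-trans (+-cong (zeroʳ (f x)) ≈-refl) (+-identityˡ _)))
  ... | true  = +-cong (≈-sym (*-identityʳ (f x))) (∑ₗ-filter P? f xs)

  ∑ₗ-applyUpTo : ∀ (f : A → ℝ) g n → ∑ₗ f (applyUpTo g n) ≈ ∑ n (f ∘ g)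
  ∑ₗ-applyUpTo f g zero    = ≈-refl
  ∑ₗ-applyUpTo f g (suc n) = +-cong ≈-refl (∑ₗ-applyUpTo f (g ∘ suc) n)

∑ₗ-cartesianProductWith : ∀ {A B C : Set} (F : C → ℝ) (g : A → B → C) xs ys →
  ∑ₗ F (cartesianProductWith g xs ys) ≈ ∑ₗ (λ x → ∑ₗ (F ∘ g x) ys) xs
∑ₗ-cartesianProductWith F g []       ys = ≈-refl
∑ₗ-cartesianProductWith F g (x ∷ xs) ys = ≈-trans (∑ₗ-++ F (List.map (g x) ys) _)
  (+-cong (≈-reflexive (cong (foldr _+_ 0ℝ) (≡.sym (map-∘ ys)))) (∑ₗ-cartesianProductWith F g xs ys))

-- Bell polynomials as values of Z

monomial : (ℕ → ℝ) → ∀ {m} → Vec ℕ m → ℝ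
monomial u v = product λ i → divPow (u (toℕ i)) (lookup v i)

-- General weights are carried because removing the first variable shifts those of the others;
-- `weightBy id` is `weight`.
weightBy : (ℕ → ℕ) → ∀ {m} → Vec ℕ m → ℕ
weightBy e v = Vec.sum (tabulate λ i → suc (e (toℕ i)) ℕ.* lookup v i)

-- Splitting off the first coordinate of the cartesian product reproduces the recursion of `Z`.
∑ₗ-tuples : ∀ b u e m Φ →
  ∑ₗ (λ v → monomial u v * Φ (Vec.sum v) (weightBy e v)) (tuples m (upTo (suc b))) ≈ Z b u e m Φ
∑ₗ-tuples b u e zero    Φ = ≈-trans (+-identityʳ _) (*-identityˡ (Φ 0 0))
∑ₗ-tuples b u e (suc m) Φ = begin
  ∑ₗ F (tuples (suc m) (upTo (suc b)))
    ≈⟨ ∑ₗ-cartesianProductWith F _∷_ (upTo (suc b)) vs ⟩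
  ∑ₗ (λ a → ∑ₗ (F ∘ (a ∷_)) vs) (upTo (suc b))
    ≈⟨ ∑ₗ-applyUpTo (λ a → ∑ₗ (F ∘ (a ∷_)) vs) id (suc b) ⟩
  ∑ (suc b) (λ a → ∑ₗ (F ∘ (a ∷_)) vs)
    ≈⟨ ∑-cong (suc b) {λ a → ∑ₗ (F ∘ (a ∷_)) vs} {summand} (λ a _ → begin
         ∑ₗ (F ∘ (a ∷_)) vs
           ≈⟨ ∑ₗ-cong (λ v → *-assoc (divPow (u 0) a) _ _) vs ⟩
         ∑ₗ (λ v → divPow (u 0) a * F′ a v) vs
           ≈⟨ ∑ₗ-*ˡ (divPow (u 0) a) (F′ a) vs ⟨
         divPow (u 0) a * ∑ₗ (F′ a) vs
           ≈⟨ *-congˡ (∑ₗ-tuples b (u ∘ suc) (e ∘ suc) m (shift (e 0) a Φ)) ⟩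
         summand a ∎) ⟩
  ∑ (suc b) summand ∎
  where
  vs : List (Vec ℕ m)
  vs = tuples m (upTo (suc b))
  F : Vec ℕ (suc m) → ℝ
  F v = monomial u v * Φ (Vec.sum v) (weightBy e v)
  F′ : ℕ → Vec ℕ m → ℝ
  F′ a v = monomial (u ∘ suc) v * shift (e 0) a Φ (Vec.sum v) (weightBy (e ∘ suc) v)
  summand : ℕ → ℝ
  summand a = divPow (u 0) a * Z b (u ∘ suc) (e ∘ suc) m (shift (e 0) a Φ)

monomial-scale : ∀ t u {m} (v : Vec ℕ m) →
  t ^ Vec.sum v * monomial u v ≈ monomial (λ j → t * u j) v
monomial-scale t u []      = *-identityˡ 1ℝ
monomial-scale t u (a ∷ v) = begin
  t ^ (a ℕ.+ Vec.sum v) * (1/ a ! * u 0 ^ a * monomial (u ∘ suc) v)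
    ≈⟨ *-congʳ (^-homo-* t a (Vec.sum v)) ⟩
  t ^ a * t ^ Vec.sum v * (1/ a ! * u 0 ^ a * monomial (u ∘ suc) v)
    ≈⟨ solve 5 (λ p q f x y → p :* q :* (f :* x :* y) := f :* (p :* x) :* (q :* y)) ≈-refl
         (t ^ a) (t ^ Vec.sum v) (1/ a !) (u 0 ^ a) (monomial (u ∘ suc) v) ⟩
  1/ a ! * (t ^ a * u 0 ^ a) * (t ^ Vec.sum v * monomial (u ∘ suc) v)
    ≈⟨ *-cong (*-congˡ (≈-sym (^-distrib-* t (u 0) a))) (monomial-scale t (u ∘ suc) v) ⟩
  1/ a ! * (t * u 0) ^ a * monomial (λ j → t * u (suc j)) v ∎

-- Each monomial of the Bell polynomial has degree `k`, so `t ^ k` distributes as one factor `t` per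
-- variable.
^-B≈n!*Z : ∀ t x n k →
  t ^ k * B n k (x ∘ toℕ) ≈
  fromℕ (n !) * Z k (λ j → t * (x j * 1/ suc j !)) id (suc (n ∸ k))
                  (λ s w → ⟦ (s ≡ᵇ k) ∧ (w ≡ᵇ n) ⟧)
^-B≈n!*Z t x n k = begin
  t ^ k * (fromℕ (n !) * ∑ₗ (monomial y) (Λ n k))
    ≈⟨ solve 3 (λ a b c → a :* (b :* c) := b :* (a :* c)) ≈-refl
         (t ^ k) (fromℕ (n !)) (∑ₗ (monomial y) (Λ n k)) ⟩
  fromℕ (n !) * (t ^ k * ∑ₗ (monomial y) (Λ n k))
    ≈⟨ *-congˡ (begin
         t ^ k * ∑ₗ (monomial y) (filter (inΛ? n k) vs)
           -- The boolean of `inΛ?` computes to the conjunction of two `≡ᵇ` tests, so the indicator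
           -- is `Φ` itself.
           ≈⟨ *-congˡ (∑ₗ-filter (inΛ? n k) (monomial y) vs) ⟩
         t ^ k * ∑ₗ (λ v → monomial y v * Φ (Vec.sum v) (weight v)) vs
           ≈⟨ ∑ₗ-*ˡ (t ^ k) (λ v → monomial y v * Φ (Vec.sum v) (weight v)) vs ⟩
         ∑ₗ (λ v → t ^ k * (monomial y v * Φ (Vec.sum v) (weight v))) vs
           ≈⟨ ∑ₗ-cong absorb vs ⟩
         ∑ₗ (λ v → monomial (λ j → t * y j) v * Φ (Vec.sum v) (weight v)) vs
           ≈⟨ ∑ₗ-tuples k (λ j → t * y j) id (suc (n ∸ k)) Φ ⟩
         Z k (λ j → t * y j) id (suc (n ∸ k)) Φ ∎) ⟩
  fromℕ (n !) * Z k (λ j → t * y j) id (suc (n ∸ k)) Φ ∎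
  where
  y : ℕ → ℝ
  y j = x j * 1/ suc j !
  Φ : ℕ → ℕ → ℝ
  Φ s w = ⟦ (s ≡ᵇ k) ∧ (w ≡ᵇ n) ⟧
  vs : List (Vec ℕ (suc (n ∸ k)))
  vs = tuples (suc (n ∸ k)) (upTo (suc k))

  ^-δ : ∀ s w → t ^ k * Φ s w ≈ t ^ s * Φ s w
  ^-δ s w with s ℕₚ.≟ k
  ... | yes refl = ≈-refl
  ... | no  s≢k  = ≈-trans (*-congˡ δ≈0) (≈-trans (zeroʳ (t ^ k))
    (≈-sym (≈-trans (*-congˡ δ≈0) (zeroʳ (t ^ s)))))
    where
    δ≈0 : Φ s w ≈ 0ℝ
    δ≈0 = ≈-trans (⟦∧⟧ (s ≡ᵇ k) (w ≡ᵇ n)) (≈-trans (*-congʳ (≢⇒⟦≡ᵇ⟧ s k s≢k)) (zeroˡ ⟦ w ≡ᵇ n ⟧))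

  absorb : ∀ v → t ^ k * (monomial y v * Φ (Vec.sum v) (weight v)) ≈
                 monomial (λ j → t * y j) v * Φ (Vec.sum v) (weight v)
  absorb v = begin
    t ^ k * (monomial y v * δ)
      ≈⟨ solve 3 (λ a b c → a :* (b :* c) := b :* (a :* c)) ≈-refl (t ^ k) (monomial y v) δ ⟩
    monomial y v * (t ^ k * δ)            ≈⟨ *-congˡ (^-δ (Vec.sum v) (weight v)) ⟩
    monomial y v * (t ^ Vec.sum v * δ)
      ≈⟨ solve 3 (λ a b c → b :* (a :* c) := a :* b :* c) ≈-refl (t ^ Vec.sum v) (monomial y v) δ ⟩
    t ^ Vec.sum v * monomial y v * δ      ≈⟨ *-congʳ (monomial-scale t y v) ⟩
    monomial (λ j → t * y j) v * δ        ∎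
    where
    δ : ℝ
    δ = Φ (Vec.sum v) (weight v)

-- Brings all `k` to a common box and a common number of variables, so that their sums can be added.
-- Entries are at most `k ≤ n`. A positive entry at a position `j > n - k` weighs `j + 1`, and the
-- other `k - 1` units weigh at least 1 each, so the total exceeds `n`.
Z-support : ∀ {n k} u → 1 ≤ k → k ≤ n → let Φ = λ s w → ⟦ (s ≡ᵇ k) ∧ (w ≡ᵇ n) ⟧ in
  Z k u id (suc (n ∸ k)) Φ ≈ Z n u id n Φ
Z-support {n} {k} u 1≤k k≤n = ≈-trans
  (Z-box u id (suc (n ∸ k)) Φ (≤⇒≤′ k≤n) λ s w _ k<s → Φ≈0 s w λ s≡k _ → ℕₚ.<⇒≢ k<s (≡.sym s≡k))
  -- Here `1 ≤ k` ensures that the `suc (n ∸ k)` variables are among the `n`.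
  (Z-pad n u id Φ (≤⇒≤′ (ℕₚ.∸-monoʳ-< 1≤k k≤n)) λ j s w n∸k<j s⊴w →
    Φ≈0 (suc s) (suc (j ℕ.+ w)) λ where
      refl 1+j+w≡n → ℕₚ.<⇒≢ (s≤s (ℕₚ.≤-trans (too-heavy n∸k<j) (ℕₚ.+-monoʳ-≤ j (proj₁ s⊴w)))) (≡.sym 1+j+w≡n))
  where
  Φ : ℕ → ℕ → ℝ
  Φ s w = ⟦ (s ≡ᵇ k) ∧ (w ≡ᵇ n) ⟧
  Φ≈0 : ∀ s w → (s ≡ k → w ≡ n → ⊥) → Φ s w ≈ 0ℝ
  Φ≈0 s w h with s ℕₚ.≟ k
  ... | no  s≢k = ≈-trans (⟦∧⟧ (s ≡ᵇ k) (w ≡ᵇ n)) (≈-trans (*-congʳ (≢⇒⟦≡ᵇ⟧ s k s≢k)) (zeroˡ _))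
  ... | yes s≡k = ≈-trans (⟦∧⟧ (s ≡ᵇ k) (w ≡ᵇ n)) (≈-trans (*-congˡ (≢⇒⟦≡ᵇ⟧ w n (h s≡k))) (zeroʳ _))
  too-heavy : ∀ {j s} → suc (n ∸ suc s) ≤ j → n ≤ j ℕ.+ s
  too-heavy {j} {s} h = ℕₚ.≤-trans (ℕₚ.m≤n+m∸n n (suc s)) (ℕₚ.≤-trans
    (ℕₚ.≤-reflexive (≡.trans (≡.sym (ℕₚ.+-suc s (n ∸ suc s))) (ℕₚ.+-comm s _)))
    (ℕₚ.+-monoˡ-≤ s h))

-- Summation over k

-- If `w` is `n ≥ 1`, then `s` lies between 1 and `n`, so exactly one index hits it.
∑⟦≡ᵇ∧≡ᵇ⟧ : ∀ n s w → 1 ≤ n → s ⊴ w →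
  ∑ n (λ i → ⟦ (s ≡ᵇ suc i) ∧ (w ≡ᵇ n) ⟧) ≈ ⟦ w ≡ᵇ n ⟧
∑⟦≡ᵇ∧≡ᵇ⟧ n zero w 1≤n (_ , s≡0⇒w≡0) = ≈-trans (∑-zero n λ _ → ≈-refl) (≈-sym (≢⇒⟦≡ᵇ⟧ w n λ w≡n →
  ℕₚ.<⇒≢ 1≤n (≡.trans (≡.sym (s≡0⇒w≡0 refl)) w≡n)))
∑⟦≡ᵇ∧≡ᵇ⟧ n (suc s) w 1≤n (s<w , _) with w ℕₚ.≟ n
... | no w≢n = ≈-trans (∑-zero n λ i → ≈-trans (⟦∧⟧ (s ≡ᵇ i) (w ≡ᵇ n))
      (≈-trans (*-congˡ δ≈0) (zeroʳ ⟦ s ≡ᵇ i ⟧))) (≈-sym δ≈0)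
  where
  δ≈0 : ⟦ w ≡ᵇ n ⟧ ≈ 0ℝ
  δ≈0 = ≢⇒⟦≡ᵇ⟧ w n w≢n
... | yes refl = begin
  ∑ n (λ i → ⟦ (s ≡ᵇ i) ∧ (n ≡ᵇ n) ⟧)
    ≈⟨ ∑-cong n (λ i _ → ≈-trans (⟦∧⟧ (s ≡ᵇ i) (n ≡ᵇ n)) (*-comm ⟦ s ≡ᵇ i ⟧ ⟦ n ≡ᵇ n ⟧)) ⟩
  ∑ n (λ i → ⟦ n ≡ᵇ n ⟧ * ⟦ s ≡ᵇ i ⟧)       ≈⟨ ∑-*ˡ n ⟦ n ≡ᵇ n ⟧ (λ i → ⟦ s ≡ᵇ i ⟧) ⟨
  ⟦ n ≡ᵇ n ⟧ * ∑ n (λ i → ⟦ s ≡ᵇ i ⟧)       ≈⟨ *-congˡ (∑⟦≡ᵇ⟧ n s s<w) ⟩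
  ⟦ n ≡ᵇ n ⟧ * 1ℝ                            ≈⟨ *-identityʳ _ ⟩
  ⟦ n ≡ᵇ n ⟧                                 ∎

-- Once the box is common to all `k`, the sum over `k` moves inside `Z` and dissolves the condition
-- on `s`. What remains is the coefficient of degree `n`.
∑^-B : ∀ t z x → (∀ j → fromℕ (suc j) * (t * (x j * 1/ suc j !)) ≈ z ^ suc j) → ∀ n → 1 ≤ n →
  ∑ n (λ i → t ^ suc i * B n (suc i) (x ∘ toℕ)) ≈ fromℕ (n !) * z ^ n
∑^-B t z x hyp n@(suc m) 1≤n = begin
  ∑ n (λ i → t ^ suc i * B n (suc i) (x ∘ toℕ))
    ≈⟨ ∑-cong n (λ i i<n → ≈-trans (^-B≈n!*Z t x n (suc i)) (*-congˡ (Z-support u (s≤s z≤n) i<n))) ⟩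
  ∑ n (λ i → fromℕ (n !) * Z n u id n (Φ i))
    ≈⟨ ∑-*ˡ n (fromℕ (n !)) (λ i → Z n u id n (Φ i)) ⟨
  fromℕ (n !) * ∑ n (λ i → Z n u id n (Φ i))
    ≈⟨ *-congˡ (begin
         ∑ n (λ i → Z n u id n (Φ i))                ≈⟨ Z-∑ n u id n n Φ ⟩
         Z n u id n (λ s w → ∑ n λ i → Φ i s w)      ≈⟨ Z-cong n u id n (λ s w → ∑⟦≡ᵇ∧≡ᵇ⟧ n s w 1≤n) ⟩
         Z n u id n (λ _ w → ⟦ w ≡ᵇ n ⟧)
           ≈⟨ Z-geometric n m u z hyp n ℕₚ.≤-refl ℕₚ.≤-refl ⟩
         z ^ n ∎) ⟩
  fromℕ (n !) * z ^ n ∎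
  where
  u : ℕ → ℝ
  u j = t * (x j * 1/ suc j !)
  Φ : ℕ → ℕ → ℕ → ℝ
  Φ i s w = ⟦ (s ≡ᵇ suc i) ∧ (w ≡ᵇ n) ⟧

-- Specialisation to the given arguments

theorem3p1 : (α β : ℝ) (n : ℕ) → 1 ≤ n →
    sum {n} (λ i → let k = suc (toℕ i) in
    (- β) ^ k * B n k (λ j → (- 1ℝ) ^ toℕ j * fromℕ (toℕ j !) * α ^ suc (toℕ j) * β ^ toℕ j))
    ≈ fromℕ (n !) * (- (α * β)) ^ n
theorem3p1 α β = ∑^-B (- β) (- (α * β))
  (λ j → (- 1ℝ) ^ j * fromℕ (j !) * α ^ suc j * β ^ j) λ j → begin
    fromℕ (suc j) * (- β * (N ^ j * fromℕ (j !) * α ^ suc j * β ^ j * 1/ suc j !))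
      -- The factorial part `(j + 1) j! / (j + 1)!`, which is 1, is separated from the signs and
      -- powers.
      ≈⟨ solve 7 (λ a b n f p q g → a :* (b :* (n :* f :* p :* q :* g)) :=
           a :* f :* g :* (b :* (n :* p :* q))) ≈-refl
           (fromℕ (suc j)) (- β) (N ^ j) (fromℕ (j !)) (α ^ suc j) (β ^ j) (1/ suc j !) ⟩
    fromℕ (suc j) * fromℕ (j !) * 1/ suc j ! * (- β * (N ^ j * α ^ suc j * β ^ j))
      ≈⟨ *-cong ([1+n]*n!*1/[1+n]!≈1 j) (powers j) ⟩
    1ℝ * (- (α * β)) ^ suc j  ≈⟨ *-identityˡ _ ⟩
    (- (α * β)) ^ suc j       ∎
  where
  N : ℝ
  N = - 1ℝ
  powers : ∀ j → - β * (N ^ j * α ^ suc j * β ^ j) ≈ (- (α * β)) ^ suc j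
  powers j = begin
    - β * (N ^ j * (α * α ^ j) * β ^ j)
      -- With `- β` written as `N * β`, the `j + 1` signs can be gathered by commutative semiring
      -- laws alone.
      ≈⟨ *-congʳ (-1*x≈-x β) ⟨
    N * β * (N ^ j * (α * α ^ j) * β ^ j)
      ≈⟨ solve 6 (λ n b p a q r → n :* b :* (p :* (a :* q) :* r) := n :* (a :* b) :* (p :* (q :* r)))
           ≈-refl N β (N ^ j) α (α ^ j) (β ^ j) ⟩
    N * (α * β) * (N ^ j * (α ^ j * β ^ j))
      ≈⟨ *-congˡ (*-congˡ (^-distrib-* α β j)) ⟨
    N * (α * β) * (N ^ j * (α * β) ^ j)
      ≈⟨ *-congˡ (^-distrib-* N (α * β) j) ⟨
    (N * (α * β)) ^ suc j
      ≈⟨ ^-congˡ (suc j) (-1*x≈-x (α * β)) ⟩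
    (- (α * β)) ^ suc j ∎
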